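{- For every real number $a$, every positive integer $m$ and every integer $n\ge 0$, $$B_n\left(\frac{ -a}{m}\right)=\sum_{k=0}^{n}\sum_{j=0}^{k}\binom{k}{j}(mj-a)^n\frac{(-1)^j}{m^n(k+1)}.$$
   Context: $B_n(t)$ denotes the $n$-th Bernoulli polynomial, defined by $\sum_{n=0}^{\infty}B_n(t)\frac{z^n}{n!}=\frac{z e^{tz}}{e^z-1}$. The convention $0^0=1$ is used. -}

module Defs where

open import Algebra.Bundles using (CommutativeRing)
open import Algebra.Structures using (IsCommutativeRing)
open import Data.Fin.Base using (Fin; zero; suc; toℕ)
open import Data.Integer.Base as ℤ using (+_; 1ℤ)
open import Data.Nat.Base as ℕ using (ℕ; zero; suc; NonZero; _!; _∸_)
import Data.Nat.Properties as ℕₚ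
open import Data.Product.Base using (∃; _,_)
open import Data.Rational.Base as ℚ using (ℚ; 0ℚ; 1ℚ; ½; ∣_∣)
import Data.Rational.Properties as ℚₚ
open import Data.Rational.Unnormalised.Base using (mkℚᵘ; *≡*)
import Data.Rational.Unnormalised.Properties as ℚᵘₚ
import Data.Rational.Solver as ℚ-Solver
open import Data.Vec.Base using (Vec; []; _∷_; lookup)
open import Level using (0ℓ)
open import Relation.Binary.PropositionalEquality as ≡ using (_≡_; refl; cong)

open ℚ-Solver.+-*-Solver using (solve; _:=_; _:+_; _:*_; _:-_; :-_)

------------------------------------------------------------------------
-- The real numbers: Cauchy sequences of rationals, two sequences being
-- equal when their difference tends to 0. Eta is switched off because comparing
-- reals field by field makes conversion checking extremely slow.

Cauchy : (ℕ → ℚ) → Set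
Cauchy s = ∀ ε → 0ℚ ℚ.< ε →
  ∃ λ N → ∀ p q → N ℕ.≤ p → N ℕ.≤ q → ∣ s p ℚ.- s q ∣ ℚ.< ε

Null : (ℕ → ℚ) → Set
Null s = ∀ ε → 0ℚ ℚ.< ε → ∃ λ N → ∀ p → N ℕ.≤ p → ∣ s p ∣ ℚ.< ε

record ℝ : Set where
  no-eta-equality
  constructor mkℝ
  field
    seq    : ℕ → ℚ
    cauchy : Cauchy seq

open ℝ public

infix 4 _≈_

record _≈_ (x y : ℝ) : Set where
  no-eta-equality
  constructor mk≈
  field
    null : Null (λ p → seq x p ℚ.- seq y p)

open _≈_ public

private

  0<½ : 0ℚ ℚ.< ½
  0<½ = ℚₚ.positive⁻¹ ½

  0<1 : 0ℚ ℚ.< 1ℚ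
  0<1 = ℚₚ.positive⁻¹ 1ℚ

  *-pos : ∀ {x y} → 0ℚ ℚ.< x → 0ℚ ℚ.< y → 0ℚ ℚ.< x ℚ.* y
  *-pos {x} {y} 0<x 0<y = ℚₚ.positive⁻¹ (x ℚ.* y)
    {{ℚₚ.pos*pos⇒pos x {{ℚ.positive 0<x}} y {{ℚ.positive 0<y}}}}

  halves : ∀ ε → ½ ℚ.* ε ℚ.+ ½ ℚ.* ε ≡ ε
  halves ε = ≡.trans (≡.sym (ℚₚ.*-distribʳ-+ ε ½ ½)) (ℚₚ.*-identityˡ ε)

  +-small : ∀ x y {ε} → ∣ x ∣ ℚ.< ½ ℚ.* ε → ∣ y ∣ ℚ.< ½ ℚ.* ε → ∣ x ℚ.+ y ∣ ℚ.< ε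
  +-small x y {ε} hx hy = begin-strict
    ∣ x ℚ.+ y ∣             ≤⟨ ℚₚ.∣p+q∣≤∣p∣+∣q∣ x y ⟩
    ∣ x ∣ ℚ.+ ∣ y ∣         <⟨ ℚₚ.+-mono-< hx hy ⟩
    ½ ℚ.* ε ℚ.+ ½ ℚ.* ε     ≡⟨ halves ε ⟩
    ε                       ∎
    where open ℚₚ.≤-Reasoning

  shrink : ∀ {K} → 0ℚ ℚ.< K → ℚ → ℚ
  shrink {K} 0<K ε = (ℚ.1/ K) {{ℚ.>-nonZero 0<K}} ℚ.* ε

  shrink-pos : ∀ {K ε} (0<K : 0ℚ ℚ.< K) → 0ℚ ℚ.< ε → 0ℚ ℚ.< shrink 0<K ε
  shrink-pos {K} {ε} 0<K 0<ε =
    *-pos {K⁻¹} {ε} (ℚₚ.positive⁻¹ K⁻¹ {{ℚₚ.1/pos⇒pos K {{ℚ.positive 0<K}}}}) 0<ε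
    where K⁻¹ = (ℚ.1/ K) {{ℚ.>-nonZero 0<K}}

  *-small : ∀ {K ε} (0<K : 0ℚ ℚ.< K) x y → ∣ x ∣ ℚ.≤ K → ∣ y ∣ ℚ.< shrink 0<K ε →
            ∣ x ℚ.* y ∣ ℚ.< ε
  *-small {K} {ε} 0<K x y hx hy = begin-strict
    ∣ x ℚ.* y ∣             ≡⟨ ℚₚ.∣p*q∣≡∣p∣*∣q∣ x y ⟩
    ∣ x ∣ ℚ.* ∣ y ∣         ≤⟨ ℚₚ.*-monoʳ-≤-nonNeg ∣ y ∣ {{ℚ.nonNegative (ℚₚ.0≤∣p∣ y)}} hx ⟩
    K ℚ.* ∣ y ∣             <⟨ ℚₚ.*-monoʳ-<-pos K {{ℚ.positive 0<K}} hy ⟩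
    K ℚ.* (K⁻¹ ℚ.* ε)       ≡⟨ ≡.sym (ℚₚ.*-assoc K K⁻¹ ε) ⟩
    (K ℚ.* K⁻¹) ℚ.* ε       ≡⟨ cong (ℚ._* ε) (ℚₚ.*-inverseʳ K {{ℚ.>-nonZero 0<K}}) ⟩
    1ℚ ℚ.* ε                ≡⟨ ℚₚ.*-identityˡ ε ⟩
    ε                       ∎
    where
    open ℚₚ.≤-Reasoning
    K⁻¹ = (ℚ.1/ K) {{ℚ.>-nonZero 0<K}}

  record EventuallyBounded (s : ℕ → ℚ) : Set where
    field
      bound   : ℚ
      0<bound : 0ℚ ℚ.< bound
      from    : ℕ
      bounded : ∀ p → from ℕ.≤ p → ∣ s p ∣ ℚ.≤ bound

  open EventuallyBounded

  cauchy⇒bounded : ∀ {s} → Cauchy s → EventuallyBounded s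
  cauchy⇒bounded {s} c with c 1ℚ 0<1
  ... | N , h = record
    { bound   = 1ℚ ℚ.+ ∣ s N ∣
    ; 0<bound = ℚₚ.+-mono-<-≤ 0<1 (ℚₚ.0≤∣p∣ (s N))
    ; from    = N
    ; bounded = λ p N≤p → begin
        ∣ s p ∣                         ≡⟨ cong ∣_∣ (solve 2 (λ x y → x := (x :- y) :+ y) refl (s p) (s N)) ⟩
        ∣ (s p ℚ.- s N) ℚ.+ s N ∣       ≤⟨ ℚₚ.∣p+q∣≤∣p∣+∣q∣ (s p ℚ.- s N) (s N) ⟩
        ∣ s p ℚ.- s N ∣ ℚ.+ ∣ s N ∣     ≤⟨ ℚₚ.+-monoˡ-≤ ∣ s N ∣ (ℚₚ.<⇒≤ (h p N N≤p ℕₚ.≤-refl)) ⟩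
        1ℚ ℚ.+ ∣ s N ∣                  ∎
    }
    where open ℚₚ.≤-Reasoning

  ⊔ˡ : ∀ {M N p} → M ℕ.⊔ N ℕ.≤ p → M ℕ.≤ p
  ⊔ˡ {M} {N} = ℕₚ.m⊔n≤o⇒m≤o M N

  ⊔ʳ : ∀ {M N p} → M ℕ.⊔ N ℕ.≤ p → N ℕ.≤ p
  ⊔ʳ {M} {N} = ℕₚ.m⊔n≤o⇒n≤o M N

  null-resp : ∀ {s t} → (∀ p → s p ≡ t p) → Null s → Null t
  null-resp eq h ε 0<ε with h ε 0<ε
  ... | N , k = N , λ p N≤p → ≡.subst (λ v → ∣ v ∣ ℚ.< ε) (eq p) (k p N≤p)

  null-0 : Null (λ _ → 0ℚ)
  null-0 ε 0<ε = 0 , λ _ _ → 0<ε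

  null-+ : ∀ {s t} → Null s → Null t → Null (λ p → s p ℚ.+ t p)
  null-+ {s} {t} hs ht ε 0<ε
    with hs (½ ℚ.* ε) (*-pos 0<½ 0<ε) | ht (½ ℚ.* ε) (*-pos 0<½ 0<ε)
  ... | M , f | N , g = M ℕ.⊔ N , λ p h →
    +-small (s p) (t p) (f p (⊔ˡ {M} h)) (g p (⊔ʳ {M} h))

  null-neg : ∀ {s} → Null s → Null (λ p → ℚ.- s p)
  null-neg {s} hs ε 0<ε with hs ε 0<ε
  ... | N , f = N , λ p h → ≡.subst (ℚ._< ε) (≡.sym (ℚₚ.∣-p∣≡∣p∣ (s p))) (f p h)

  null-* : ∀ {s t} → EventuallyBounded s → Null t → Null (λ p → s p ℚ.* t p)
  null-* {s} {t} b ht ε 0<ε with ht _ (shrink-pos (0<bound b) 0<ε)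
  ... | N , f = from b ℕ.⊔ N , λ p h →
    *-small (0<bound b) (s p) (t p) (bounded b p (⊔ˡ {from b} h)) (f p (⊔ʳ {from b} h))

infixl 6 _+_ _-_
infixl 7 _*_
infix  8 -_

fromℚ : ℚ → ℝ
fromℚ q = mkℝ (λ _ → q) λ ε 0<ε → 0 , λ _ _ _ _ →
  ≡.subst (ℚ._< ε) (≡.sym (cong ∣_∣ (ℚₚ.+-inverseʳ q))) 0<ε

fromℕ : ℕ → ℝ
fromℕ n = fromℚ (+ n ℚ./ 1)

0ℝ 1ℝ : ℝ
0ℝ = fromℚ 0ℚ
1ℝ = fromℚ 1ℚ

_+_ : ℝ → ℝ → ℝ
seq (x + y) p = seq x p ℚ.+ seq y p
cauchy (x + y) ε 0<ε
  with cauchy x (½ ℚ.* ε) (*-pos 0<½ 0<ε) | cauchy y (½ ℚ.* ε) (*-pos 0<½ 0<ε)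
... | M , f | N , g = M ℕ.⊔ N , λ p q hp hq →
  ≡.subst (λ v → ∣ v ∣ ℚ.< ε)
    (solve 4 (λ a b c d → (a :- b) :+ (c :- d) := (a :+ c) :- (b :+ d)) refl
      (seq x p) (seq x q) (seq y p) (seq y q))
    (+-small (seq x p ℚ.- seq x q) (seq y p ℚ.- seq y q)
      (f p q (⊔ˡ {M} hp) (⊔ˡ {M} hq)) (g p q (⊔ʳ {M} hp) (⊔ʳ {M} hq)))

-_ : ℝ → ℝ
seq (- x) p = ℚ.- seq x p
cauchy (- x) ε 0<ε with cauchy x ε 0<ε
... | N , f = N , λ p q hp hq →
  ≡.subst (λ v → ∣ v ∣ ℚ.< ε)
    (solve 2 (λ a b → b :- a := (:- a) :- (:- b)) refl (seq x p) (seq x q))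
    (f q p hq hp)

_-_ : ℝ → ℝ → ℝ
x - y = x + - y

_*_ : ℝ → ℝ → ℝ
seq (x * y) p = seq x p ℚ.* seq y p
cauchy (x * y) ε 0<ε =
  let bx = cauchy⇒bounded (cauchy x)
      by = cauchy⇒bounded (cauchy y)
      0<½ε = *-pos 0<½ 0<ε
      M , f = cauchy x _ (shrink-pos (0<bound by) 0<½ε)
      N , g = cauchy y _ (shrink-pos (0<bound bx) 0<½ε)
      L = (from bx ℕ.⊔ from by) ℕ.⊔ (M ℕ.⊔ N)
      F = from bx ℕ.⊔ from by
  in L , λ p q hp hq →
  ≡.subst (λ v → ∣ v ∣ ℚ.< ε)
    (solve 4 (λ a b c d → a :* (c :- d) :+ d :* (a :- b) := a :* c :- b :* d) refl
      (seq x p) (seq x q) (seq y p) (seq y q))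
    (+-small (seq x p ℚ.* (seq y p ℚ.- seq y q)) (seq y q ℚ.* (seq x p ℚ.- seq x q))
      (*-small (0<bound bx) (seq x p) (seq y p ℚ.- seq y q)
        (bounded bx p (⊔ˡ {from bx} (⊔ˡ {F} hp)))
        (g p q (⊔ʳ {M} (⊔ʳ {F} hp)) (⊔ʳ {M} (⊔ʳ {F} hq))))
      (*-small (0<bound by) (seq y q) (seq x p ℚ.- seq x q)
        (bounded by q (⊔ʳ {from bx} (⊔ˡ {F} hq)))
        (f p q (⊔ˡ {M} (⊔ʳ {F} hp)) (⊔ˡ {M} (⊔ʳ {F} hq)))))

pointwise : ∀ {x y} → (∀ p → seq x p ≡ seq y p) → x ≈ y
pointwise {x} {y} eq = mk≈ (null-resp
  (λ p → ≡.sym (≡.trans (cong (ℚ._- seq y p) (eq p)) (ℚₚ.+-inverseʳ (seq y p)))) null-0)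

private

  ≈-sym : ∀ {x y} → x ≈ y → y ≈ x
  ≈-sym {x} {y} h = mk≈ (null-resp
    (λ p → solve 2 (λ a b → :- (a :- b) := b :- a) refl (seq x p) (seq y p))
    (null-neg (null h)))

  ≈-trans : ∀ {x y z} → x ≈ y → y ≈ z → x ≈ z
  ≈-trans {x} {y} {z} h k = mk≈ (null-resp
    (λ p → solve 3 (λ a b c → (a :- b) :+ (b :- c) := a :- c) refl
             (seq x p) (seq y p) (seq z p))
    (null-+ (null h) (null k)))

  +-cong : ∀ {x y u v} → x ≈ y → u ≈ v → x + u ≈ y + v
  +-cong {x} {y} {u} {v} h k = mk≈ (null-resp
    (λ p → solve 4 (λ a b c d → (a :- b) :+ (c :- d) := (a :+ c) :- (b :+ d)) refl
             (seq x p) (seq y p) (seq u p) (seq v p))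
    (null-+ (null h) (null k)))

  neg-cong : ∀ {x y} → x ≈ y → - x ≈ - y
  neg-cong {x} {y} h = mk≈ (null-resp
    (λ p → solve 2 (λ a b → :- (a :- b) := (:- a) :- (:- b)) refl (seq x p) (seq y p))
    (null-neg (null h)))

  *-cong : ∀ {x y u v} → x ≈ y → u ≈ v → x * u ≈ y * v
  *-cong {x} {y} {u} {v} h k = mk≈ (null-resp
    (λ p → solve 4 (λ a b c d → a :* (c :- d) :+ d :* (a :- b) := a :* c :- b :* d) refl
             (seq x p) (seq y p) (seq u p) (seq v p))
    (null-+ {λ p → seq x p ℚ.* (seq u p ℚ.- seq v p)} {λ p → seq v p ℚ.* (seq x p ℚ.- seq y p)}
      (null-* {seq x} (cauchy⇒bounded (cauchy x)) (null k))
      (null-* {seq v} (cauchy⇒bounded (cauchy v)) (null h))))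

ℝ-isCommutativeRing : IsCommutativeRing _≈_ _+_ _*_ -_ 0ℝ 1ℝ
ℝ-isCommutativeRing = record
  { isRing = record
    { +-isAbelianGroup = record
      { isGroup = record
        { isMonoid = record
          { isSemigroup = record
            { isMagma = record
              { isEquivalence = record
                { refl  = pointwise λ _ → refl
                ; sym   = ≈-sym
                ; trans = ≈-trans
                }
              ; ∙-cong = +-cong
              }
            ; assoc = λ x y z → pointwise λ p → ℚₚ.+-assoc (seq x p) (seq y p) (seq z p)
            }
          ; identity = (λ x → pointwise λ p → ℚₚ.+-identityˡ (seq x p))
                     , (λ x → pointwise λ p → ℚₚ.+-identityʳ (seq x p))
          }
        ; inverse = (λ x → pointwise λ p → ℚₚ.+-inverseˡ (seq x p))
                  , (λ x → pointwise λ p → ℚₚ.+-inverseʳ (seq x p))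
        ; ⁻¹-cong = neg-cong
        }
      ; comm = λ x y → pointwise λ p → ℚₚ.+-comm (seq x p) (seq y p)
      }
    ; *-cong = *-cong
    ; *-assoc = λ x y z → pointwise λ p → ℚₚ.*-assoc (seq x p) (seq y p) (seq z p)
    ; *-identity = (λ x → pointwise λ p → ℚₚ.*-identityˡ (seq x p))
                 , (λ x → pointwise λ p → ℚₚ.*-identityʳ (seq x p))
    ; distrib = (λ x y z → pointwise λ p → ℚₚ.*-distribˡ-+ (seq x p) (seq y p) (seq z p))
              , (λ x y z → pointwise λ p → ℚₚ.*-distribʳ-+ (seq x p) (seq y p) (seq z p))
    }
  ; *-comm = λ x y → pointwise λ p → ℚₚ.*-comm (seq x p) (seq y p)
  }

ℝ-commutativeRing : CommutativeRing 0ℓ 0ℓ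
ℝ-commutativeRing = record { isCommutativeRing = ℝ-isCommutativeRing }

open CommutativeRing ℝ-commutativeRing public using (semiring; +-monoid)
private module R = CommutativeRing ℝ-commutativeRing

-- x ^ 0 is 1ℝ for every x, so 0 ^ 0 = 1.
open import Algebra.Properties.Semiring.Exp semiring public using (_^_)
open import Algebra.Properties.Monoid.Sum +-monoid public using (sum; sum-syntax; sum⁺-syntax; sum-cong-≋)

infixl 7 _/_

_/_ : ℝ → (n : ℕ) → .{{NonZero n}} → ℝ
x / n = x * fromℚ (1ℤ ℚ./ n)

m^n*[1+k]≢0 : ∀ m n k .{{_ : NonZero m}} → NonZero (m ℕ.^ n ℕ.* suc k)
m^n*[1+k]≢0 m n k = ℕₚ.m*n≢0 (m ℕ.^ n) (suc k) {{ℕₚ.m^n≢0 m n}}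

------------------------------------------------------------------------
-- Formal power series in z over ℝ, given by their coefficients.

PowerSeries : Set
PowerSeries = ℕ → ℝ

infix  4 _≋_
infixl 6 _⊖_
infixl 7 _⊛_ _⊘_

_≋_ : PowerSeries → PowerSeries → Set
f ≋ g = ∀ n → f n ≈ g n

one : PowerSeries
one zero    = 1ℝ
one (suc _) = 0ℝ

z : PowerSeries
z zero          = 0ℝ
z (suc zero)    = 1ℝ
z (suc (suc _)) = 0ℝ

_⊖_ : PowerSeries → PowerSeries → PowerSeries
(f ⊖ g) n = f n - g n

_⊛_ : PowerSeries → PowerSeries → PowerSeries
(f ⊛ g) n = ∑[ i ≤ n ] (f (toℕ i) * g (n ∸ toℕ i))

-- f / z for a series f without constant term.
divide-z : PowerSeries → PowerSeries
divide-z f n = f (suc n)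

-- The coefficient c n of c = f / g, for a series g with constant term 1, from
-- c (n - 1) ∷ … ∷ c 0 ∷ []:  c n = f n - (g 1 * c (n - 1) + … + g n * c 0).
next : PowerSeries → PowerSeries → (n : ℕ) → Vec ℝ n → ℝ
next f g n cs = f n - ∑[ i < n ] (g (suc (toℕ i)) * lookup cs i)

coefficients : PowerSeries → PowerSeries → (n : ℕ) → Vec ℝ n
coefficients f g zero    = []
coefficients f g (suc n) = next f g n cs ∷ cs
  where cs = coefficients f g n

_⊘_ : PowerSeries → PowerSeries → PowerSeries
(f ⊘ g) n = next f g n (coefficients f g n)

-- ∑ a_n z^n / n!
egf : (ℕ → ℝ) → PowerSeries
egf a n = (a n / n !) {{n ℕₚ.!≢0}}

-- e^{tz}
exp : ℝ → PowerSeries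
exp t = egf (λ n → t ^ n)

-- The generating function z e^{tz} / (e^z - 1); numerator and denominator have
-- no constant term, so both are divided by z first, which gives the denominator
-- the constant term 1 (see bernoulli-gf).
bernoulliSeries : ℝ → PowerSeries
bernoulliSeries t = divide-z (z ⊛ exp t) ⊘ divide-z (exp 1ℝ ⊖ one)

-- B_n(t)
bernoulli : ℕ → ℝ → ℝ
bernoulli n t = fromℕ (n !) * bernoulliSeries t n

private

  lookup-coefficients : ∀ f g n (i : Fin n) →
    lookup (coefficients f g n) i ≡ (f ⊘ g) (n ∸ suc (toℕ i))
  lookup-coefficients f g (suc n) zero    = refl
  lookup-coefficients f g (suc n) (suc i) = lookup-coefficients f g n i

open import Relation.Binary.Reasoning.Setoid (CommutativeRing.setoid ℝ-commutativeRing)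

⊘-correct : ∀ f g → g 0 ≈ 1ℝ → g ⊛ (f ⊘ g) ≋ f
⊘-correct f g g₀≈1 n = begin
  g 0 * (f ⊘ g) n + S                ≈⟨ R.+-congʳ (R.*-congʳ g₀≈1) ⟩
  1ℝ * (f ⊘ g) n + S                 ≈⟨ R.+-congʳ (R.*-identityˡ _) ⟩
  (f n - S′) + S                     ≈⟨ R.+-congˡ S≈S′ ⟩
  (f n - S′) + S′                    ≈⟨ R.+-assoc (f n) (- S′) S′ ⟩
  f n + (- S′ + S′)                  ≈⟨ R.+-congˡ (R.-‿inverseˡ S′) ⟩
  f n + 0ℝ                           ≈⟨ R.+-identityʳ (f n) ⟩
  f n                                ∎
  where
  S S′ : ℝ
  S  = sum {n} (λ i → g (suc (toℕ i)) * (f ⊘ g) (n ∸ suc (toℕ i)))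
  S′ = sum {n} (λ i → g (suc (toℕ i)) * lookup (coefficients f g n) i)
  S≈S′ : S ≈ S′
  S≈S′ = sum-cong-≋ {n} λ i →
    R.*-congˡ (R.reflexive (≡.sym (lookup-coefficients f g n i)))

private

  n*1/n : ∀ n .{{_ : NonZero n}} → (+ n ℚ./ 1) ℚ.* (1ℤ ℚ./ n) ≡ 1ℚ
  n*1/n n@(suc m) = ℚₚ.toℚᵘ-injective (ℚᵘₚ.≃-trans
    (ℚₚ.toℚᵘ-homo-* (+ n ℚ./ 1) (1ℤ ℚ./ n))
    (ℚᵘₚ.≃-trans
      (ℚᵘₚ.*-cong (ℚₚ.toℚᵘ-fromℚᵘ (mkℚᵘ (+ n) 0)) (ℚₚ.toℚᵘ-fromℚᵘ (mkℚᵘ 1ℤ m)))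
      (*≡* (cong (+_) (eq n)))))
    where
    eq : ∀ n → n ℕ.* 1 ℕ.* 1 ≡ 1 ℕ.* (1 ℕ.* n)
    eq n = ≡.trans (≡.trans (ℕₚ.*-identityʳ (n ℕ.* 1)) (ℕₚ.*-identityʳ n))
      (≡.sym (≡.trans (ℕₚ.*-identityˡ (1 ℕ.* n)) (ℕₚ.*-identityˡ n)))

/-cancel : ∀ n .{{_ : NonZero n}} x → (fromℕ n * x) / n ≈ x
/-cancel n x = pointwise λ p → ≡.trans
  (solve 3 (λ a b c → (a :* b) :* c := b :* (a :* c)) refl (+ n ℚ./ 1) (seq x p) (1ℤ ℚ./ n))
  (≡.trans (cong (seq x p ℚ.*_) (n*1/n n)) (ℚₚ.*-identityʳ (seq x p)))

private

  e⁰-1≈0 : (exp 1ℝ ⊖ one) 0 ≈ 0ℝ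
  e⁰-1≈0 = pointwise λ _ → refl

-- (e^z - 1) * ∑ B_n(t) z^n / n! = z e^{tz}
bernoulli-gf : ∀ t → (exp 1ℝ ⊖ one) ⊛ egf (λ n → bernoulli n t) ≋ z ⊛ exp t
bernoulli-gf t zero    = R.+-congʳ (R.trans
  (R.*-congʳ e⁰-1≈0)
  (R.trans (R.zeroˡ _) (R.sym (R.zeroˡ _))))
bernoulli-gf t (suc n) = begin
  g 0 * b (suc n) + (divide-z g ⊛ b) n
    ≈⟨ R.+-congʳ (R.*-congʳ e⁰-1≈0) ⟩
  0ℝ * b (suc n) + (divide-z g ⊛ b) n
    ≈⟨ R.+-congʳ (R.zeroˡ (b (suc n))) ⟩
  0ℝ + (divide-z g ⊛ b) n
    ≈⟨ R.+-identityˡ _ ⟩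
  (divide-z g ⊛ b) n
    ≈⟨ sum-cong-≋ {suc n} (λ i → R.*-congˡ {divide-z g (toℕ i)}
         (/-cancel ((n ∸ toℕ i) !) {{(n ∸ toℕ i) ℕₚ.!≢0}} (bernoulliSeries t (n ∸ toℕ i)))) ⟩
  (divide-z g ⊛ bernoulliSeries t) n
    ≈⟨ ⊘-correct (divide-z (z ⊛ exp t)) (divide-z g) (pointwise λ _ → refl) n ⟩
  (z ⊛ exp t) (suc n)
    ∎
  where
  g b : PowerSeries
  g = exp 1ℝ ⊖ one
  b = egf (λ n → bernoulli n t)

{-# OPTIONS --safe #-}

-- Write E for the shift operator (E f)(j) = f(j + 1) and D for differentiation.
-- Since e^D = E on polynomials, B_n(t) is the value at 0 of D / (E - 1) applied
-- to f(j) = (t + j)^n, and expanding D = log (1 - (1 - E)) in powers of 1 - E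
-- gives ∑ (1 - E)^k / (k + 1), a finite sum because (1 - E)^k lowers degrees by
-- k. For t = - a / m this is the right-hand side of the theorem. The expansion
-- of D is elementary: (1 - E)^(k + 1) (j q) = - (k + 1) (1 - E)^k E q at 0, and
-- ∑ (1 - E)^k E q telescopes to q.

module Submission where

open import Defs
open import Data.Nat.Base as ℕ using (ℕ; suc; NonZero)
open import Data.Nat.Combinatorics using (_C_)
open import Data.Fin.Base using (toℕ)

open import Algebra.Bundles using (CommutativeRing)
open import Data.Fin.Base using (Fin; zero; suc)
import Data.Fin.Properties as Finₚ
open import Data.Integer.Base as ℤ using (+_; 1ℤ)
import Data.Integer.Properties as ℤₚ
open import Data.Nat.Base using (zero; _!; _∸_; z≤n; s≤s)
open import Data.Nat.Combinatorics
  using (nCk≡n!/k![n-k]!; k![n∸k]!∣n!; nCk+nC[k+1]≡[n+1]C[k+1]; k>n⇒nCk≡0)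
open import Data.Nat.DivMod using (m/n*n≡m)
open import Data.Nat.Induction using (<-rec)
import Data.Nat.Properties as ℕₚ
open import Data.Rational.Base as ℚ using (1ℚ)
import Data.Rational.Properties as ℚₚ
import Data.Rational.Solver as ℚ-Solver
open import Data.Rational.Unnormalised.Base as ℚᵘ using (mkℚᵘ; *≡*)
import Data.Rational.Unnormalised.Properties as ℚᵘₚ
open import Function.Base using (_∘_)
open import Relation.Binary.PropositionalEquality as ≡ using (_≡_)

private module R = CommutativeRing ℝ-commutativeRing

open import Algebra.Properties.Ring R.ring using (-0#≈0#; -1*x≈-x)
open import Algebra.Properties.Semiring.Sum R.semiring
  using (∑-distrib-+; *-distribˡ-sum; *-distribʳ-sum; sum-replicate-zero)
open import Algebra.Properties.Semiring.Mult R.semiring using (_×_; ×-cong; ×-assoc-*; ×1-homo-*)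
open import Algebra.Properties.CommutativeSemiring.Exp R.commutativeSemiring
  using (^-congˡ; ^-distrib-*)
import Algebra.Properties.CommutativeSemiring.Binomial R.commutativeSemiring as Binomial
open import Relation.Binary.Reasoning.Setoid R.setoid

open ℚ-Solver.+-*-Solver using (solve; con; _:=_; _:+_; _:*_; _:-_; :-_)

-- Natural numbers and their reciprocals in ℝ

-- `+ n ℚ./ 1` does not reduce for a variable `n`, so the equation is checked on unnormalised
-- representatives, where it becomes one between integers.
fromℕ-suc : ∀ n → fromℕ (suc n) ≈ 1ℝ + fromℕ n
fromℕ-suc n = pointwise λ _ → ℚₚ.toℚᵘ-injective (ℚᵘₚ.≃-trans
  (ℚₚ.toℚᵘ-fromℚᵘ (mkℚᵘ (+ suc n) 0))
  (ℚᵘₚ.≃-sym (ℚᵘₚ.≃-trans (ℚₚ.toℚᵘ-homo-+ 1ℚ (+ n ℚ./ 1))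
    (ℚᵘₚ.≃-trans (ℚᵘₚ.+-congʳ ℚᵘ.1ℚᵘ (ℚₚ.toℚᵘ-fromℚᵘ (mkℚᵘ (+ n) 0)))
      (*≡* (≡.cong (λ k → (+ 1 ℤ.+ k) ℤ.* + 1) (ℤₚ.*-identityʳ (+ n))))))))

fromℕ≈×1 : ∀ n → fromℕ n ≈ n × 1ℝ
fromℕ≈×1 zero    = R.refl
fromℕ≈×1 (suc n) = R.trans (fromℕ-suc n) (R.+-congˡ (fromℕ≈×1 n))

fromℕ-+ : ∀ m n → fromℕ (m ℕ.+ n) ≈ fromℕ m + fromℕ n
fromℕ-+ zero    n = R.sym (R.+-identityˡ (fromℕ n))
fromℕ-+ (suc m) n = begin
  fromℕ (suc (m ℕ.+ n))         ≈⟨ fromℕ-suc (m ℕ.+ n) ⟩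
  1ℝ + fromℕ (m ℕ.+ n)          ≈⟨ R.+-congˡ (fromℕ-+ m n) ⟩
  1ℝ + (fromℕ m + fromℕ n)      ≈⟨ R.+-assoc 1ℝ (fromℕ m) (fromℕ n) ⟨
  (1ℝ + fromℕ m) + fromℕ n      ≈⟨ R.+-congʳ (fromℕ-suc m) ⟨
  fromℕ (suc m) + fromℕ n       ∎

fromℕ-* : ∀ m n → fromℕ (m ℕ.* n) ≈ fromℕ m * fromℕ n
fromℕ-* m n = begin
  fromℕ (m ℕ.* n)       ≈⟨ fromℕ≈×1 (m ℕ.* n) ⟩
  (m ℕ.* n) × 1ℝ        ≈⟨ ×1-homo-* m n ⟩
  (m × 1ℝ) * (n × 1ℝ)   ≈⟨ R.*-cong (fromℕ≈×1 m) (fromℕ≈×1 n) ⟨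
  fromℕ m * fromℕ n     ∎

fromℕ-^ : ∀ m n → fromℕ (m ℕ.^ n) ≈ fromℕ m ^ n
fromℕ-^ m zero    = R.refl
fromℕ-^ m (suc n) = R.trans (fromℕ-* m (m ℕ.^ n)) (R.*-congˡ (fromℕ-^ m n))

×≈fromℕ* : ∀ n x → n × x ≈ fromℕ n * x
×≈fromℕ* n x = begin
  n × x           ≈⟨ ×-cong {n} ≡.refl (R.*-identityˡ x) ⟨
  n × (1ℝ * x)    ≈⟨ ×-assoc-* n 1ℝ x ⟨
  (n × 1ℝ) * x    ≈⟨ R.*-congʳ (fromℕ≈×1 n) ⟨
  fromℕ n * x     ∎

recip : (n : ℕ) → .{{NonZero n}} → ℝ
recip n = fromℚ (1ℤ ℚ./ n)

recip-inverse : ∀ n .{{_ : NonZero n}} → fromℕ n * recip n ≈ 1ℝ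
recip-inverse n = R.trans (R.*-congʳ (R.sym (R.*-identityʳ (fromℕ n)))) (/-cancel n 1ℝ)

-- Every later identity between reciprocals goes through this uniqueness: it is enough to multiply
-- out, and no fraction has to be normalised.
recip-unique : ∀ n .{{_ : NonZero n}} {x} → fromℕ n * x ≈ 1ℝ → x ≈ recip n
recip-unique n {x} eq = begin
  x                           ≈⟨ /-cancel n x ⟨
  (fromℕ n * x) * recip n     ≈⟨ R.*-congʳ eq ⟩
  1ℝ * recip n                ≈⟨ R.*-identityˡ (recip n) ⟩
  recip n                     ∎

recip-* : ∀ m n .{{_ : NonZero m}} .{{_ : NonZero n}} .{{_ : NonZero (m ℕ.* n)}} →
          recip (m ℕ.* n) ≈ recip m * recip n
recip-* m n = R.sym (recip-unique (m ℕ.* n) (begin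
  fromℕ (m ℕ.* n) * (recip m * recip n)           ≈⟨ R.*-congʳ (fromℕ-* m n) ⟩
  fromℕ m * fromℕ n * (recip m * recip n)         ≈⟨ interchange (fromℕ m) (fromℕ n) (recip m) (recip n) ⟩
  (fromℕ m * recip m) * (fromℕ n * recip n)       ≈⟨ R.*-cong (recip-inverse m) (recip-inverse n) ⟩
  1ℝ * 1ℝ                                         ≈⟨ R.*-identityˡ 1ℝ ⟩
  1ℝ                                              ∎))
  where
  interchange : ∀ a b c d → a * b * (c * d) ≈ (a * c) * (b * d)
  interchange a b c d = pointwise λ p →
    solve 4 (λ a b c d → a :* b :* (c :* d) := (a :* c) :* (b :* d)) ≡.refl
      (seq a p) (seq b p) (seq c p) (seq d p)

-- Finite sums

sum-cong : ∀ n {f g : Fin n → ℝ} → (∀ i → f i ≈ g i) → sum f ≈ sum g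
sum-cong n = sum-cong-≋ {n}

sum-zero : ∀ n {f : Fin n → ℝ} → (∀ i → f i ≈ 0ℝ) → sum f ≈ 0ℝ
sum-zero n f≈0 = R.trans (sum-cong n f≈0) (sum-replicate-zero n)

sum-neg : ∀ n (f : Fin n → ℝ) → ∑[ i < n ] (- f i) ≈ - sum f
sum-neg n f = begin
  ∑[ i < n ] (- f i)          ≈⟨ sum-cong n (λ i → -1*x≈-x (f i)) ⟨
  ∑[ i < n ] (- 1ℝ * f i)     ≈⟨ *-distribˡ-sum (- 1ℝ) f ⟨
  - 1ℝ * sum f                ≈⟨ -1*x≈-x (sum f) ⟩
  - sum f                     ∎

sum-minus : ∀ n (f g : Fin n → ℝ) → ∑[ i < n ] (f i - g i) ≈ sum f - sum g
sum-minus n f g = R.trans (∑-distrib-+ f (λ i → - g i)) (R.+-congˡ (sum-neg n g))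

sum-truncate : ∀ {m n} → m ℕ.≤ n → (f : ℕ → ℝ) → (∀ k → m ℕ.≤ k → f k ≈ 0ℝ) →
               ∑[ k < n ] f (toℕ k) ≈ ∑[ k < m ] f (toℕ k)
sum-truncate {n = n} z≤n f vanishes = sum-zero n (λ k → vanishes (toℕ k) z≤n)
sum-truncate (s≤s m≤n) f vanishes =
  R.+-congˡ (sum-truncate m≤n (f ∘ suc) (λ k m≤k → vanishes (suc k) (s≤s m≤k)))

sum-telescope : ∀ n (f : ℕ → ℝ) → ∑[ k < n ] (f (toℕ k) - f (suc (toℕ k))) ≈ f 0 - f n
sum-telescope zero    f = R.sym (R.-‿inverseʳ (f 0))
sum-telescope (suc n) f = R.trans (R.+-congˡ (sum-telescope n (f ∘ suc))) (cancel (f 0) (f 1) (f (suc n)))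
  where
  cancel : ∀ a b c → (a - b) + (b - c) ≈ a - c
  cancel a b c = pointwise λ p →
    solve 3 (λ a b c → (a :- b) :+ (b :- c) := a :- c) ≡.refl (seq a p) (seq b p) (seq c p)

-- Linear functionals on sequences

-- Shared by `δ k` and `logE/[E-1] N`. `L-sum` is what moves the second of them through a Cauchy
-- product.
record Linear (L : (ℕ → ℝ) → ℝ) : Set where
  field
    L-cong : ∀ {f g} → (∀ j → f j ≈ g j) → L f ≈ L g
    L-+    : ∀ f g → L (λ j → f j + g j) ≈ L f + L g
    L-*    : ∀ c f → L (λ j → c * f j) ≈ c * L f

  L-0 : L (λ _ → 0ℝ) ≈ 0ℝ
  L-0 = begin
    L (λ _ → 0ℝ)            ≈⟨ L-cong (λ _ → R.zeroˡ 0ℝ) ⟨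
    L (λ _ → 0ℝ * 0ℝ)       ≈⟨ L-* 0ℝ (λ _ → 0ℝ) ⟩
    0ℝ * L (λ _ → 0ℝ)       ≈⟨ R.zeroˡ (L (λ _ → 0ℝ)) ⟩
    0ℝ                      ∎

  L-minus : ∀ f g → L (λ j → f j - g j) ≈ L f - L g
  L-minus f g = begin
    L (λ j → f j - g j)                 ≈⟨ L-+ f (λ j → - g j) ⟩
    L f + L (λ j → - g j)               ≈⟨ R.+-congˡ (L-cong (λ j → -1*x≈-x (g j))) ⟨
    L f + L (λ j → - 1ℝ * g j)          ≈⟨ R.+-congˡ (L-* (- 1ℝ) g) ⟩
    L f + - 1ℝ * L g                    ≈⟨ R.+-congˡ (-1*x≈-x (L g)) ⟩
    L f - L g                           ∎

  L-sum : ∀ n (F : Fin n → ℕ → ℝ) → L (λ j → ∑[ i < n ] F i j) ≈ ∑[ i < n ] L (F i)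
  L-sum zero    F = L-0
  L-sum (suc n) F = R.trans
    (L-+ (F zero) (λ j → ∑[ i < n ] F (suc i) j))
    (R.+-congˡ (L-sum n (F ∘ suc)))

open Linear

-- Iterated differences: δ k f is the value of (1 - E)^k f at 0.

δ : ℕ → (ℕ → ℝ) → ℝ
δ zero    f = f 0
δ (suc k) f = δ k f - δ k (f ∘ suc)

δ-linear : ∀ k → Linear (δ k)
δ-linear zero = record
  { L-cong = λ f≈g → f≈g 0
  ; L-+    = λ _ _ → R.refl
  ; L-*    = λ _ _ → R.refl
  }
δ-linear (suc k) = record
  { L-cong = λ f≈g → R.+-cong (L-cong ih f≈g) (R.-‿cong (L-cong ih (f≈g ∘ suc)))
  ; L-+    = λ f g → R.trans
      (R.+-cong (L-+ ih f g) (R.-‿cong (L-+ ih (f ∘ suc) (g ∘ suc))))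
      (regroup (δ k f) (δ k g) (δ k (f ∘ suc)) (δ k (g ∘ suc)))
  ; L-*    = λ c f → R.trans
      (R.+-cong (L-* ih c f) (R.-‿cong (L-* ih c (f ∘ suc))))
      (factor c (δ k f) (δ k (f ∘ suc)))
  }
  where
  ih = δ-linear k
  regroup : ∀ a b c d → (a + b) - (c + d) ≈ (a - c) + (b - d)
  regroup a b c d = pointwise λ p →
    solve 4 (λ a b c d → (a :+ b) :- (c :+ d) := (a :- c) :+ (b :- d)) ≡.refl
      (seq a p) (seq b p) (seq c p) (seq d p)
  factor : ∀ c a b → c * a - c * b ≈ c * (a - b)
  factor c a b = pointwise λ p →
    solve 3 (λ c a b → c :* a :- c :* b := c :* (a :- b)) ≡.refl
      (seq c p) (seq a p) (seq b p)

-- This is E = 1 - (1 - E), composed with (1 - E)^k.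
δ-shift : ∀ k f → δ k (f ∘ suc) ≈ δ k f - δ (suc k) f
δ-shift k f = cancel (δ k f) (δ k (f ∘ suc))
  where
  cancel : ∀ a b → b ≈ a - (a - b)
  cancel a b = pointwise λ p →
    solve 2 (λ a b → b := a :- (a :- b)) ≡.refl (seq a p) (seq b p)

δ-const : ∀ k c → δ (suc k) (λ _ → c) ≈ 0ℝ
δ-const k c = R.-‿inverseʳ (δ k (λ _ → c))

-- Since E j - j E = E as operators, commuting (1 - E)^(k + 1) past multiplication by j leaves - (k
-- + 1) (1 - E)^k E. The other term carries a factor j and vanishes at 0.
δ-id* : ∀ k f → δ (suc k) (λ j → fromℕ j * f j) ≈ - (fromℕ (suc k) * δ k (f ∘ suc))
δ-id* zero f = simplify (f 0) (f 1)
  where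
  simplify : ∀ a b → 0ℝ * a - 1ℝ * b ≈ - (1ℝ * b)
  simplify a b = R.trans (R.+-congʳ (R.zeroˡ a)) (R.+-identityˡ (- (1ℝ * b)))
δ-id* (suc k) f = begin
  δ (suc k) (λ j → fromℕ j * f j) - δ (suc k) (λ j → fromℕ (suc j) * f (suc j))
    ≈⟨ R.+-cong (δ-id* k f) (R.-‿cong shifted) ⟩
  - (fromℕ (suc k) * a) - ((a - b) - fromℕ (suc k) * b)
    ≈⟨ collect (fromℕ (suc k)) a b ⟩
  - ((1ℝ + fromℕ (suc k)) * (a - b))
    ≈⟨ R.-‿cong (R.*-congʳ (fromℕ-suc (suc k))) ⟨
  - (fromℕ (suc (suc k)) * (a - b))
    ∎
  where
  -- By the definition of `δ`, `a - b` is `δ (suc k) (f ∘ suc)`.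
  a = δ k (f ∘ suc)
  b = δ k (λ j → f (suc (suc j)))
  collect : ∀ n a b → - (n * a) - ((a - b) - n * b) ≈ - ((1ℝ + n) * (a - b))
  collect n a b = pointwise λ p →
    solve 3 (λ n a b → :- (n :* a) :- ((a :- b) :- n :* b) := :- ((con 1ℚ :+ n) :* (a :- b))) ≡.refl
      (seq n p) (seq a p) (seq b p)
  distribute : ∀ n a → (1ℝ + n) * a ≈ a + n * a
  distribute n a = pointwise λ p →
    solve 2 (λ n a → (con 1ℚ :+ n) :* a := a :+ n :* a) ≡.refl
      (seq n p) (seq a p)
  -- Splitting j + 1 gives one plain copy of `f ∘ suc`, which raises the factor by 1, and a product
  -- with j to which the induction hypothesis applies.
  shifted : δ (suc k) (λ j → fromℕ (suc j) * f (suc j)) ≈ (a - b) - fromℕ (suc k) * b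
  shifted = begin
    δ (suc k) (λ j → fromℕ (suc j) * f (suc j))
      ≈⟨ L-cong (δ-linear (suc k)) (λ j → R.trans
           (R.*-congʳ (fromℕ-suc j)) (distribute (fromℕ j) (f (suc j)))) ⟩
    δ (suc k) (λ j → f (suc j) + fromℕ j * f (suc j))
      ≈⟨ L-+ (δ-linear (suc k)) (f ∘ suc) (λ j → fromℕ j * f (suc j)) ⟩
    (a - b) + δ (suc k) (λ j → fromℕ j * f (suc j))
      ≈⟨ R.+-congˡ (δ-id* k (f ∘ suc)) ⟩
    (a - b) - fromℕ (suc k) * b
      ∎

-- The coefficient of E^j in (1 - E)^k.
sign : ℕ → ℕ → ℝ
sign k j = fromℕ (k C j) * (- 1ℝ) ^ j

-- Pascal's rule, read as a comparison of the coefficients of E^(j + 1) in (1 - E)^(k + 1) = (1 -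
-- E)^k - E (1 - E)^k.
sign-suc : ∀ k j → sign (suc k) (suc j) ≈ sign k (suc j) - sign k j
sign-suc k j = begin
  fromℕ (suc k C suc j) * (- 1ℝ * s)
    ≈⟨ R.*-congʳ (R.reflexive (≡.cong fromℕ (nCk+nC[k+1]≡[n+1]C[k+1] k j))) ⟨
  fromℕ (k C j ℕ.+ k C suc j) * (- 1ℝ * s)
    ≈⟨ R.*-cong (fromℕ-+ (k C j) (k C suc j)) (-1*x≈-x s) ⟩
  (fromℕ (k C j) + fromℕ (k C suc j)) * - s
    ≈⟨ expand (fromℕ (k C j)) (fromℕ (k C suc j)) s ⟩
  fromℕ (k C suc j) * - s - fromℕ (k C j) * s
    ≈⟨ R.+-congʳ (R.*-congˡ (-1*x≈-x s)) ⟨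
  sign k (suc j) - sign k j
    ∎
  where
  s = (- 1ℝ) ^ j
  expand : ∀ a b s → (a + b) * - s ≈ b * - s - a * s
  expand a b s = pointwise λ p →
    solve 3 (λ a b s → (a :+ b) :* :- s := b :* :- s :- a :* s) ≡.refl
      (seq a p) (seq b p) (seq s p)

δ-binomial : ∀ k f → δ k f ≈ ∑[ j ≤ k ] (sign k (toℕ j) * f (toℕ j))
δ-binomial zero f = R.sym (begin
  (1ℝ * 1ℝ) * f 0 + 0ℝ    ≈⟨ R.+-identityʳ _ ⟩
  (1ℝ * 1ℝ) * f 0         ≈⟨ R.*-congʳ (R.*-identityˡ 1ℝ) ⟩
  1ℝ * f 0                ≈⟨ R.*-identityˡ (f 0) ⟩
  f 0                     ∎)
δ-binomial (suc k) f = begin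
  δ k f - δ k (f ∘ suc)
    ≈⟨ R.+-cong (δ-binomial k f) (R.-‿cong (δ-binomial k (f ∘ suc))) ⟩
  ∑[ j ≤ k ] term (toℕ j) - S
    -- The first sum gains the summand at `suc k`, which is zero because `k C suc k` is. After its
    -- summand at 0 is split off, it has as many summands as `S`.
    ≈⟨ R.+-congʳ (sum-truncate (ℕₚ.n≤1+n (suc k)) term beyond) ⟨
  ∑[ j ≤ suc k ] term (toℕ j) - S
    ≈⟨ R.+-assoc (term 0) (∑[ j ≤ k ] term (suc (toℕ j))) (- S) ⟩
  term 0 + (∑[ j ≤ k ] term (suc (toℕ j)) - S)
    ≈⟨ R.+-congˡ (sum-minus (suc k) (λ j → term (suc (toℕ j))) (λ j → sign k (toℕ j) * f (suc (toℕ j)))) ⟨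
  term 0 + ∑[ j ≤ k ] (term (suc (toℕ j)) - sign k (toℕ j) * f (suc (toℕ j)))
    -- The summands at 0 for `k` and `suc k` agree by computation, so Pascal's rule is needed only
    -- for the others.
    ≈⟨ R.+-congˡ {term 0} (sum-cong (suc k) (λ j → pascal (toℕ j))) ⟨
  ∑[ j ≤ suc k ] (sign (suc k) (toℕ j) * f (toℕ j))
    ∎
  where
  term : ℕ → ℝ
  term j = sign k j * f j
  S = ∑[ j ≤ k ] (sign k (toℕ j) * f (suc (toℕ j)))
  beyond : ∀ j → suc k ℕ.≤ j → term j ≈ 0ℝ
  beyond j k<j = begin
    fromℕ (k C j) * (- 1ℝ) ^ j * f j      ≈⟨ R.*-congʳ (R.*-congʳ (R.reflexive (≡.cong fromℕ (k>n⇒nCk≡0 k<j)))) ⟩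
    0ℝ * (- 1ℝ) ^ j * f j                 ≈⟨ R.*-congʳ (R.zeroˡ ((- 1ℝ) ^ j)) ⟩
    0ℝ * f j                              ≈⟨ R.zeroˡ (f j) ⟩
    0ℝ                                    ∎
  pascal : ∀ j → sign (suc k) (suc j) * f (suc j) ≈ term (suc j) - sign k j * f (suc j)
  pascal j = R.trans (R.*-congʳ (sign-suc k j)) (split (sign k (suc j)) (sign k j) (f (suc j)))
    where
    split : ∀ a b c → (a - b) * c ≈ a * c - b * c
    split a b c = pointwise λ p →
      solve 3 (λ a b c → (a :- b) :* c := a :* c :- b :* c) ≡.refl
        (seq a p) (seq b p) (seq c p)

-- Polynomial sequences of degree at most d, seen through their vanishing differences

Degree≤ : ℕ → (ℕ → ℝ) → Set
Degree≤ d f = ∀ k → d ℕ.≤ k → δ (suc k) f ≈ 0ℝ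

degree-const : ∀ d c → Degree≤ d (λ _ → c)
degree-const d c k _ = δ-const k c

degree-+ : ∀ {d f g} → Degree≤ d f → Degree≤ d g → Degree≤ d (λ j → f j + g j)
degree-+ {f = f} {g} hf hg k d≤k = begin
  δ (suc k) (λ j → f j + g j)         ≈⟨ L-+ (δ-linear (suc k)) f g ⟩
  δ (suc k) f + δ (suc k) g           ≈⟨ R.+-cong (hf k d≤k) (hg k d≤k) ⟩
  0ℝ + 0ℝ                             ≈⟨ R.+-identityˡ 0ℝ ⟩
  0ℝ                                  ∎

-- By `δ-id*` and `δ-shift`, a difference of the product at 0 is a combination of two consecutive
-- differences of `f` at 0. This is why `Degree≤` speaks of all orders above `d`: one vanishing
-- value at 0 would not force the next.
degree-* : ∀ t {d f} → Degree≤ d f → Degree≤ (suc d) (λ j → (t + fromℕ j) * f j)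
degree-* t {d} {f} hf (suc k) (s≤s d≤k) = begin
  δ K (λ j → (t + fromℕ j) * f j)
    ≈⟨ L-cong (δ-linear K) (λ j → R.distribʳ (f j) t (fromℕ j)) ⟩
  δ K (λ j → t * f j + fromℕ j * f j)
    ≈⟨ L-+ (δ-linear K) (λ j → t * f j) (λ j → fromℕ j * f j) ⟩
  δ K (λ j → t * f j) + δ K (λ j → fromℕ j * f j)
    ≈⟨ R.+-cong (L-* (δ-linear K) t f) (δ-id* (suc k) f) ⟩
  t * δ K f - fromℕ K * δ (suc k) (f ∘ suc)
    ≈⟨ R.+-cong (R.*-congˡ δf≈0) (R.-‿cong (R.*-congˡ (δ-shift (suc k) f))) ⟩
  t * 0ℝ - fromℕ K * (δ (suc k) f - δ K f)
    ≈⟨ R.+-congˡ (R.-‿cong (R.*-congˡ (R.+-cong (hf k d≤k) (R.-‿cong δf≈0)))) ⟩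
  t * 0ℝ - fromℕ K * (0ℝ - 0ℝ)
    ≈⟨ R.+-cong (R.zeroʳ t) (R.-‿cong (R.trans (R.*-congˡ (R.-‿inverseʳ 0ℝ)) (R.zeroʳ (fromℕ K)))) ⟩
  0ℝ - 0ℝ
    ≈⟨ R.-‿inverseʳ 0ℝ ⟩
  0ℝ
    ∎
  where
  K = suc (suc k)
  δf≈0 : δ K f ≈ 0ℝ
  δf≈0 = hf (suc k) (ℕₚ.m≤n⇒m≤1+n d≤k)

power : ℝ → ℕ → ℕ → ℝ
power t n j = (t + fromℕ j) ^ n

degree-power : ∀ t n → Degree≤ n (power t n)
degree-power t zero    = degree-const 0 1ℝ
degree-power t (suc n) = degree-* t (degree-power t n)

-- ((t + j)^(n + 1) - t^(n + 1)) / j, so that its value at j = 0 is a derivative.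
quotient : ℝ → ℕ → ℕ → ℝ
quotient t zero    j = 1ℝ
quotient t (suc n) j = (t + fromℕ j) * quotient t n j + t ^ suc n

degree-quotient : ∀ t n → Degree≤ n (quotient t n)
degree-quotient t zero    = degree-const 0 1ℝ
degree-quotient t (suc n) = degree-+ (degree-* t (degree-quotient t n)) (degree-const (suc n) (t ^ suc n))

-- Multiplying the identity for n by t + j and collecting the factor j yields exactly the recursion
-- of `quotient`. Nothing is divided by j, so j = 0 is covered.
power-quotient : ∀ t n j → power t (suc n) j ≈ t ^ suc n + fromℕ j * quotient t n j
power-quotient t zero    j = R.distribʳ 1ℝ t (fromℕ j)
power-quotient t (suc n) j = R.trans
  (R.*-congˡ (power-quotient t n j))
  (expand t (fromℕ j) (t ^ suc n) (quotient t n j))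
  where
  expand : ∀ t j a b → (t + j) * (a + j * b) ≈ t * a + j * ((t + j) * b + a)
  expand t j a b = pointwise λ p →
    solve 4 (λ t j a b → (t :+ j) :* (a :+ j :* b) := t :* a :+ j :* ((t :+ j) :* b :+ a)) ≡.refl
      (seq t p) (seq j p) (seq a p) (seq b p)

-- At j = 0 the recursion of `quotient` is the product rule for the derivative of x * x^(n + 1) at
-- t.
quotient-0 : ∀ t n → quotient t n 0 ≈ fromℕ (suc n) * t ^ n
quotient-0 t zero    = R.sym (R.*-identityˡ 1ℝ)
quotient-0 t (suc n) = begin
  (t + 0ℝ) * quotient t n 0 + t ^ suc n         ≈⟨ R.+-congʳ (R.*-cong (R.+-identityʳ t) (quotient-0 t n)) ⟩
  t * (fromℕ (suc n) * t ^ n) + t * t ^ n       ≈⟨ collect t (fromℕ (suc n)) (t ^ n) ⟩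
  (1ℝ + fromℕ (suc n)) * t ^ suc n              ≈⟨ R.*-congʳ (fromℕ-suc (suc n)) ⟨
  fromℕ (suc (suc n)) * t ^ suc n               ∎
  where
  collect : ∀ t n x → t * (n * x) + t * x ≈ (1ℝ + n) * (t * x)
  collect t n x = pointwise λ p →
    solve 3 (λ t n x → t :* (n :* x) :+ t :* x := (con 1ℚ :+ n) :* (t :* x)) ≡.refl
      (seq t p) (seq n p) (seq x p)

-- The operator D / (E - 1) at 0

logE/[E-1] : ℕ → (ℕ → ℝ) → ℝ
logE/[E-1] N f = ∑[ k ≤ N ] (recip (suc (toℕ k)) * δ (toℕ k) f)

logE/[E-1]-linear : ∀ N → Linear (logE/[E-1] N)
logE/[E-1]-linear N = record
  { L-cong = λ f≈g → sum-cong (suc N) λ k →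
      R.*-congˡ {recip (suc (toℕ k))} (L-cong (δ-linear (toℕ k)) f≈g)
  ; L-+    = λ f g → R.trans
      (sum-cong (suc N) λ k → R.trans
        (R.*-congˡ {recip (suc (toℕ k))} (L-+ (δ-linear (toℕ k)) f g))
        (R.distribˡ (recip (suc (toℕ k))) (δ (toℕ k) f) (δ (toℕ k) g)))
      (∑-distrib-+ {suc N} (λ k → recip (suc (toℕ k)) * δ (toℕ k) f) (λ k → recip (suc (toℕ k)) * δ (toℕ k) g))
  ; L-*    = λ c f → R.trans
      (sum-cong (suc N) λ k → R.trans
        (R.*-congˡ {recip (suc (toℕ k))} (L-* (δ-linear (toℕ k)) c f))
        (swap (recip (suc (toℕ k))) c (δ (toℕ k) f)))
      (R.sym (*-distribˡ-sum {suc N} c (λ k → recip (suc (toℕ k)) * δ (toℕ k) f)))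
  }
  where
  swap : ∀ r c x → r * (c * x) ≈ c * (r * x)
  swap r c x = pointwise λ p →
    solve 3 (λ r c x → r :* (c :* x) := c :* (r :* x)) ≡.refl
      (seq r p) (seq c p) (seq x p)

-- Terms of order above the degree vanish, so coefficients of different degrees can all be evaluated
-- with one common truncation.
logE/[E-1]-stable : ∀ {i N f} → i ℕ.≤ N → Degree≤ i f → logE/[E-1] N f ≈ logE/[E-1] i f
logE/[E-1]-stable {f = f} i≤N hf = sum-truncate (s≤s i≤N) (λ k → recip (suc k) * δ k f) vanish
  where
  vanish : ∀ k → suc _ ℕ.≤ k → recip (suc k) * δ k f ≈ 0ℝ
  vanish (suc k) (s≤s i≤k) = R.trans (R.*-congˡ {recip (suc (suc k))} (hf k i≤k)) (R.zeroʳ (recip (suc (suc k))))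

-- D / (E - 1) applied to (E - 1) f is the derivative of f at 0, which for f = c + j q is `q 0`. The
-- factor k + 1 from `δ-id*` cancels the denominator of the logarithm series, what remains
-- telescopes by `δ-shift`, and the degree of `q` kills the far end.
logE/[E-1]-Δ : ∀ N c {q} → Degree≤ N q →
  logE/[E-1] N (λ j → (c + fromℕ (suc j) * q (suc j)) - (c + fromℕ j * q j)) ≈ q 0
logE/[E-1]-Δ N c {q} hq = begin
  logE/[E-1] N (λ j → f (suc j) - f j)
    ≈⟨ sum-cong (suc N) (λ k → term (toℕ k)) ⟩
  ∑[ k ≤ N ] (δ (toℕ k) q - δ (suc (toℕ k)) q)
    ≈⟨ sum-telescope (suc N) (λ k → δ k q) ⟩
  q 0 - δ (suc N) q
    ≈⟨ R.+-congˡ (R.-‿cong (hq N ℕₚ.≤-refl)) ⟩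
  q 0 - 0ℝ
    ≈⟨ R.+-congˡ -0#≈0# ⟩
  q 0 + 0ℝ
    ≈⟨ R.+-identityʳ (q 0) ⟩
  q 0
    ∎
  where
  f : ℕ → ℝ
  f j = c + fromℕ j * q j
  flip : ∀ a b → b - a ≈ - (a - b)
  flip a b = pointwise λ p →
    solve 2 (λ a b → b :- a := :- (a :- b)) ≡.refl
      (seq a p) (seq b p)
  cancel : ∀ r n x → r * - (- (n * x)) ≈ (n * r) * x
  cancel r n x = pointwise λ p →
    solve 3 (λ r n x → r :* :- (:- (n :* x)) := (n :* r) :* x) ≡.refl
      (seq r p) (seq n p) (seq x p)
  δf : ∀ k → δ (suc k) f ≈ - (fromℕ (suc k) * δ k (q ∘ suc))
  δf k = begin
    δ (suc k) f
      ≈⟨ L-+ (δ-linear (suc k)) (λ _ → c) (λ j → fromℕ j * q j) ⟩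
    δ (suc k) (λ _ → c) + δ (suc k) (λ j → fromℕ j * q j)
      ≈⟨ R.+-cong (δ-const k c) (δ-id* k q) ⟩
    0ℝ - fromℕ (suc k) * δ k (q ∘ suc)
      ≈⟨ R.+-identityˡ (- (fromℕ (suc k) * δ k (q ∘ suc))) ⟩
    - (fromℕ (suc k) * δ k (q ∘ suc))
      ∎
  term : ∀ k → recip (suc k) * δ k (λ j → f (suc j) - f j) ≈ δ k q - δ (suc k) q
  term k = begin
    recip (suc k) * δ k (λ j → f (suc j) - f j)
      ≈⟨ R.*-congˡ {recip (suc k)} (L-minus (δ-linear k) (f ∘ suc) f) ⟩
    recip (suc k) * (δ k (f ∘ suc) - δ k f)
      ≈⟨ R.*-congˡ {recip (suc k)} (flip (δ k f) (δ k (f ∘ suc))) ⟩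
    recip (suc k) * - δ (suc k) f
      ≈⟨ R.*-congˡ {recip (suc k)} (R.-‿cong (δf k)) ⟩
    recip (suc k) * - (- (fromℕ (suc k) * δ k (q ∘ suc)))
      ≈⟨ cancel (recip (suc k)) (fromℕ (suc k)) (δ k (q ∘ suc)) ⟩
    (fromℕ (suc k) * recip (suc k)) * δ k (q ∘ suc)
      ≈⟨ R.*-congʳ (recip-inverse (suc k)) ⟩
    1ℝ * δ k (q ∘ suc)
      ≈⟨ R.*-identityˡ (δ k (q ∘ suc)) ⟩
    δ k (q ∘ suc)
      ≈⟨ δ-shift k q ⟩
    δ k q - δ (suc k) q
      ∎

-- Power series

recip-! : ℕ → ℝ
recip-! n = recip (n !) {{n ℕₚ.!≢0}}

recip-!-inverse : ∀ n → fromℕ (n !) * recip-! n ≈ 1ℝ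
recip-!-inverse n = recip-inverse (n !) {{n ℕₚ.!≢0}}

recip-!-suc : ∀ n → fromℕ (suc n) * recip-! (suc n) ≈ recip-! n
recip-!-suc n = recip-unique (n !) {{n ℕₚ.!≢0}} (begin
  fromℕ (n !) * (fromℕ (suc n) * recip-! (suc n))     ≈⟨ regroup (fromℕ (n !)) (fromℕ (suc n)) (recip-! (suc n)) ⟩
  (fromℕ (suc n) * fromℕ (n !)) * recip-! (suc n)     ≈⟨ R.*-congʳ (fromℕ-* (suc n) (n !)) ⟨
  fromℕ (suc n !) * recip-! (suc n)                   ≈⟨ recip-!-inverse (suc n) ⟩
  1ℝ                                                  ∎)
  where
  regroup : ∀ a b c → a * (b * c) ≈ (b * a) * c
  regroup a b c = pointwise λ p →
    solve 3 (λ a b c → a :* (b :* c) := (b :* a) :* c) ≡.refl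
      (seq a p) (seq b p) (seq c p)

nCk*k![n∸k]!≡n! : ∀ {n k} → k ℕ.≤ n → (n C k) ℕ.* (k ! ℕ.* (n ∸ k) !) ≡ n !
nCk*k![n∸k]!≡n! {n} {k} k≤n = ≡.trans
  (≡.cong (ℕ._* (k ! ℕ.* (n ∸ k) !)) (nCk≡n!/k![n-k]! k≤n))
  (m/n*n≡m {{k ℕₚ.!* (n ∸ k) !≢0}} (k![n∸k]!∣n! k≤n))

nCk/n! : ∀ {n k} → k ℕ.≤ n → fromℕ (n C k) * recip-! n ≈ recip-! k * recip-! (n ∸ k)
nCk/n! {n} {k} k≤n = R.trans
  (recip-unique (k ! ℕ.* (n ∸ k) !) {{k ℕₚ.!* (n ∸ k) !≢0}} (begin
    fromℕ d * (fromℕ (n C k) * recip-! n)     ≈⟨ regroup (fromℕ d) (fromℕ (n C k)) (recip-! n) ⟩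
    (fromℕ (n C k) * fromℕ d) * recip-! n     ≈⟨ R.*-congʳ (fromℕ-* (n C k) d) ⟨
    fromℕ ((n C k) ℕ.* d) * recip-! n         ≈⟨ R.*-congʳ (R.reflexive (≡.cong fromℕ (nCk*k![n∸k]!≡n! k≤n))) ⟩
    fromℕ (n !) * recip-! n                   ≈⟨ recip-!-inverse n ⟩
    1ℝ                                        ∎))
  (recip-* (k !) ((n ∸ k) !) {{k ℕₚ.!≢0}} {{(n ∸ k) ℕₚ.!≢0}} {{k ℕₚ.!* (n ∸ k) !≢0}})
  where
  d = k ! ℕ.* (n ∸ k) !
  regroup : ∀ a b c → a * (b * c) ≈ (b * a) * c
  regroup a b c = pointwise λ p →
    solve 3 (λ a b c → a :* (b :* c) := (b :* a) :* c) ≡.refl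
      (seq a p) (seq b p) (seq c p)

exp-cong : ∀ {x y} → x ≈ y → exp x ≋ exp y
exp-cong x≈y n = R.*-congʳ (^-congˡ n x≈y)

-- The binomial theorem divided by n!, each binomial coefficient over n! being split into 1 / k! and
-- 1 / (n - k)!.
exp-+ : ∀ x y → exp x ⊛ exp y ≋ exp (x + y)
exp-+ x y n = R.sym (begin
  (x + y) ^ n * recip-! n
    ≈⟨ R.*-congʳ (Binomial.theorem n x y) ⟩
  ∑[ k ≤ n ] ((n C toℕ k) × (x ^ toℕ k * y ^ (n ∸ toℕ k))) * recip-! n
    ≈⟨ *-distribʳ-sum (recip-! n) (λ (k : Fin (suc n)) → (n C toℕ k) × (x ^ toℕ k * y ^ (n ∸ toℕ k))) ⟩
  ∑[ k ≤ n ] ((n C toℕ k) × (x ^ toℕ k * y ^ (n ∸ toℕ k)) * recip-! n)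
    ≈⟨ sum-cong (suc n) (λ k → term (toℕ k) (Finₚ.toℕ≤pred[n] k)) ⟩
  (exp x ⊛ exp y) n
    ∎)
  where
  pull : ∀ c u v r → c * (u * v) * r ≈ (u * v) * (c * r)
  pull c u v r = pointwise λ p →
    solve 4 (λ c u v r → c :* (u :* v) :* r := (u :* v) :* (c :* r)) ≡.refl
      (seq c p) (seq u p) (seq v p) (seq r p)
  interchange : ∀ u v r s → (u * v) * (r * s) ≈ (u * r) * (v * s)
  interchange u v r s = pointwise λ p →
    solve 4 (λ u v r s → (u :* v) :* (r :* s) := (u :* r) :* (v :* s)) ≡.refl
      (seq u p) (seq v p) (seq r p) (seq s p)
  term : ∀ k → k ℕ.≤ n → (n C k) × (x ^ k * y ^ (n ∸ k)) * recip-! n ≈ exp x k * exp y (n ∸ k)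
  term k k≤n = begin
    (n C k) × (x ^ k * y ^ (n ∸ k)) * recip-! n
      ≈⟨ R.*-congʳ (×≈fromℕ* (n C k) (x ^ k * y ^ (n ∸ k))) ⟩
    fromℕ (n C k) * (x ^ k * y ^ (n ∸ k)) * recip-! n
      ≈⟨ pull (fromℕ (n C k)) (x ^ k) (y ^ (n ∸ k)) (recip-! n) ⟩
    (x ^ k * y ^ (n ∸ k)) * (fromℕ (n C k) * recip-! n)
      ≈⟨ R.*-congˡ (nCk/n! k≤n) ⟩
    (x ^ k * y ^ (n ∸ k)) * (recip-! k * recip-! (n ∸ k))
      ≈⟨ interchange (x ^ k) (y ^ (n ∸ k)) (recip-! k) (recip-! (n ∸ k)) ⟩
    exp x k * exp y (n ∸ k)
      ∎

-- Multiplication by e^z - 1 is the difference operator E - 1 acting on the exponent x, which is the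
-- operator that `logE/[E-1]` inverts up to D.
divide-z-[e-1]⊛exp : ∀ x n →
  (divide-z (exp 1ℝ ⊖ one) ⊛ exp x) n ≈ exp (1ℝ + x) (suc n) - exp x (suc n)
divide-z-[e-1]⊛exp x n = begin
  (divide-z (exp 1ℝ ⊖ one) ⊛ exp x) n
    ≈⟨ sum-cong (suc n) (λ i → R.*-congʳ {exp x (n ∸ toℕ i)} (R.trans (R.+-congˡ -0#≈0#) (R.+-identityʳ (exp 1ℝ (suc (toℕ i)))))) ⟩
  S
    -- `S` is the Cauchy product of e^z and e^(xz) at `suc n` without its first summand, and that
    -- summand is `e`.
    ≈⟨ cancel e S ⟩
  (1ℝ * e + S) - e
    ≈⟨ R.+-congʳ (R.+-congʳ (R.*-congʳ (R.*-identityˡ 1ℝ))) ⟨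
  (exp 1ℝ ⊛ exp x) (suc n) - e
    ≈⟨ R.+-congʳ (exp-+ 1ℝ x (suc n)) ⟩
  exp (1ℝ + x) (suc n) - e
    ∎
  where
  e = exp x (suc n)
  S = (divide-z (exp 1ℝ) ⊛ exp x) n
  cancel : ∀ a b → b ≈ (1ℝ * a + b) - a
  cancel a b = pointwise λ p →
    solve 2 (λ a b → b := (con 1ℚ :* a :+ b) :- a) ≡.refl
      (seq a p) (seq b p)

divide-z-z⊛ : ∀ f → divide-z (z ⊛ f) ≋ f
divide-z-z⊛ f n = begin
  0ℝ * f (suc n) + (1ℝ * f n + ∑[ i < n ] (0ℝ * f (n ∸ suc (toℕ i))))
    ≈⟨ R.+-cong (R.zeroˡ (f (suc n))) (R.+-cong (R.*-identityˡ (f n)) (sum-zero n (λ i → R.zeroˡ (f (n ∸ suc (toℕ i)))))) ⟩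
  0ℝ + (f n + 0ℝ)
    ≈⟨ R.+-identityˡ (f n + 0ℝ) ⟩
  f n + 0ℝ
    ≈⟨ R.+-identityʳ (f n) ⟩
  f n
    ∎

-- With constant term 1, coefficient n of the product is `c n` plus a combination of earlier
-- coefficients of `c`. Strong induction therefore recovers `c` from the product.
⊛-cancelˡ : ∀ {g c d} → g 0 ≈ 1ℝ → g ⊛ c ≋ g ⊛ d → c ≋ d
⊛-cancelˡ {g} {c} {d} g₀≈1 eq = <-rec (λ n → c n ≈ d n) step
  where
  earlier : ∀ {n} (i : Fin n) → n ∸ suc (toℕ i) ℕ.< n
  earlier {suc n} i = s≤s (ℕₚ.m∸n≤m n (toℕ i))
  leading : ∀ f n → f n ≈ (g ⊛ f) n - ∑[ i < n ] (g (suc (toℕ i)) * f (n ∸ suc (toℕ i)))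
  leading f n = R.trans (cancel (f n) S) (R.+-congʳ (R.+-congʳ (R.*-congʳ (R.sym g₀≈1))))
    where
    S = ∑[ i < n ] (g (suc (toℕ i)) * f (n ∸ suc (toℕ i)))
    cancel : ∀ a b → a ≈ (1ℝ * a + b) - b
    cancel a b = pointwise λ p →
      solve 2 (λ a b → a := (con 1ℚ :* a :+ b) :- b) ≡.refl
        (seq a p) (seq b p)
  step : ∀ n → (∀ {i} → i ℕ.< n → c i ≈ d i) → c n ≈ d n
  step n ih = begin
    c n
      ≈⟨ leading c n ⟩
    (g ⊛ c) n - ∑[ i < n ] (g (suc (toℕ i)) * c (n ∸ suc (toℕ i)))
      ≈⟨ R.+-cong (eq n) (R.-‿cong (sum-cong n (λ i → R.*-congˡ {g (suc (toℕ i))} (ih (earlier i))))) ⟩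
    (g ⊛ d) n - ∑[ i < n ] (g (suc (toℕ i)) * d (n ∸ suc (toℕ i)))
      ≈⟨ leading d n ⟨
    d n
      ∎

-- Bernoulli polynomials

-- For t = - a / m this is the right-hand side of the theorem, with the sum over j still in the form
-- of a difference.
bernoulliSum : ℝ → ℕ → ℝ
bernoulliSum t n = logE/[E-1] n (power t n)

-- As a series in z, this is the operator acting on j in e^((t + j)z). The truncation is raised to
-- an `N` independent of the coefficient, so that one operator serves a whole Cauchy product.
egf-bernoulliSum : ∀ t {i N} → i ℕ.≤ N →
  egf (bernoulliSum t) i ≈ logE/[E-1] N (λ j → exp (t + fromℕ j) i)
egf-bernoulliSum t {i} {N} i≤N = begin
  bernoulliSum t i * recip-! i
    ≈⟨ R.*-comm (bernoulliSum t i) (recip-! i) ⟩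
  recip-! i * bernoulliSum t i
    ≈⟨ R.*-congˡ (logE/[E-1]-stable i≤N (degree-power t i)) ⟨
  recip-! i * logE/[E-1] N (power t i)
    ≈⟨ L-* (logE/[E-1]-linear N) (recip-! i) (power t i) ⟨
  logE/[E-1] N (λ j → recip-! i * power t i j)
    ≈⟨ L-cong (logE/[E-1]-linear N) (λ j → R.*-comm (recip-! i) (power t i j)) ⟩
  logE/[E-1] N (λ j → exp (t + fromℕ j) i)
    ∎

-- The result is the derivative of x^(n + 1) / (n + 1)! at t. It comes from `logE/[E-1]-Δ` with the
-- difference quotient as `q`, whose degree n fits the truncation.
logE/[E-1]-Δexp : ∀ t n →
  logE/[E-1] n (λ j → exp (t + fromℕ (suc j)) (suc n) - exp (t + fromℕ j) (suc n)) ≈ exp t n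
logE/[E-1]-Δexp t n = begin
  logE/[E-1] n (λ j → power t (suc n) (suc j) * r - power t (suc n) j * r)
    ≈⟨ L-cong (logE/[E-1]-linear n) (λ j → R.trans
         (R.+-cong (R.*-congʳ (power-quotient t n (suc j))) (R.-‿cong (R.*-congʳ (power-quotient t n j))))
         (factor (f (suc j)) (f j) r)) ⟩
  logE/[E-1] n (λ j → r * (f (suc j) - f j))
    ≈⟨ L-* (logE/[E-1]-linear n) r (λ j → f (suc j) - f j) ⟩
  r * logE/[E-1] n (λ j → f (suc j) - f j)
    ≈⟨ R.*-congˡ (logE/[E-1]-Δ n (t ^ suc n) (degree-quotient t n)) ⟩
  r * quotient t n 0
    ≈⟨ R.*-congˡ (quotient-0 t n) ⟩
  r * (fromℕ (suc n) * t ^ n)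
    ≈⟨ regroup r (fromℕ (suc n)) (t ^ n) ⟩
  t ^ n * (fromℕ (suc n) * r)
    ≈⟨ R.*-congˡ (recip-!-suc n) ⟩
  t ^ n * recip-! n
    ∎
  where
  r = recip-! (suc n)
  f : ℕ → ℝ
  f j = t ^ suc n + fromℕ j * quotient t n j
  factor : ∀ a b c → a * c - b * c ≈ c * (a - b)
  factor a b c = pointwise λ p →
    solve 3 (λ a b c → a :* c :- b :* c := c :* (a :- b)) ≡.refl
      (seq a p) (seq b p) (seq c p)
  regroup : ∀ a b c → a * (b * c) ≈ c * (b * a)
  regroup a b c = pointwise λ p →
    solve 3 (λ a b c → a :* (b :* c) := c :* (b :* a)) ≡.refl
      (seq a p) (seq b p) (seq c p)

-- The operator acts on j and the Cauchy product on z, so they commute. Under the operator, (e^z -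
-- 1) / z turns e^((t + j)z) into a difference in j, whose image is e^(tz).
bernoulliSum-gf : ∀ t →
  divide-z (exp 1ℝ ⊖ one) ⊛ egf (bernoulliSum t) ≋ divide-z (z ⊛ exp t)
bernoulliSum-gf t n = begin
  (g ⊛ egf (bernoulliSum t)) n
    ≈⟨ sum-cong (suc n) (λ i → R.trans
         (R.*-congˡ {g (toℕ i)} (egf-bernoulliSum t (ℕₚ.m∸n≤m n (toℕ i))))
         (R.sym (L-* (logE/[E-1]-linear n) (g (toℕ i)) (λ j → e j (n ∸ toℕ i))))) ⟩
  ∑[ i ≤ n ] logE/[E-1] n (λ j → g (toℕ i) * e j (n ∸ toℕ i))
    ≈⟨ L-sum (logE/[E-1]-linear n) (suc n) (λ i j → g (toℕ i) * e j (n ∸ toℕ i)) ⟨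
  logE/[E-1] n (λ j → (g ⊛ e j) n)
    ≈⟨ L-cong (logE/[E-1]-linear n) (λ j → R.trans
         (divide-z-[e-1]⊛exp (t + fromℕ j) n)
         (R.+-congʳ (exp-cong (1+[t+j] j) (suc n)))) ⟩
  logE/[E-1] n (λ j → e (suc j) (suc n) - e j (suc n))
    ≈⟨ logE/[E-1]-Δexp t n ⟩
  exp t n
    ≈⟨ divide-z-z⊛ (exp t) n ⟨
  divide-z (z ⊛ exp t) n
    ∎
  where
  g : PowerSeries
  g = divide-z (exp 1ℝ ⊖ one)
  e : ℕ → PowerSeries
  e j = exp (t + fromℕ j)
  swap : ∀ a b c → a + (b + c) ≈ b + (a + c)
  swap a b c = pointwise λ p →
    solve 3 (λ a b c → a :+ (b :+ c) := b :+ (a :+ c)) ≡.refl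
      (seq a p) (seq b p) (seq c p)
  1+[t+j] : ∀ j → 1ℝ + (t + fromℕ j) ≈ t + fromℕ (suc j)
  1+[t+j] j = R.trans (swap 1ℝ t (fromℕ j)) (R.+-congˡ (R.sym (fromℕ-suc j)))

-- Both series have the same product with (e^z - 1) / z, whose constant term is 1, so that factor
-- cancels.
bernoulli≈bernoulliSum : ∀ n t → bernoulli n t ≈ bernoulliSum t n
bernoulli≈bernoulliSum n t = begin
  fromℕ (n !) * bernoulliSeries t n
    ≈⟨ R.*-congˡ (⊛-cancelˡ {g} {bernoulliSeries t} {egf (bernoulliSum t)} g₀≈1 same n) ⟩
  fromℕ (n !) * (bernoulliSum t n * recip-! n)
    ≈⟨ regroup (fromℕ (n !)) (bernoulliSum t n) (recip-! n) ⟩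
  (fromℕ (n !) * recip-! n) * bernoulliSum t n
    ≈⟨ R.*-congʳ (recip-!-inverse n) ⟩
  1ℝ * bernoulliSum t n
    ≈⟨ R.*-identityˡ (bernoulliSum t n) ⟩
  bernoulliSum t n
    ∎
  where
  g : PowerSeries
  g = divide-z (exp 1ℝ ⊖ one)
  g₀≈1 : g 0 ≈ 1ℝ
  g₀≈1 = pointwise λ _ → ≡.refl
  same : g ⊛ bernoulliSeries t ≋ g ⊛ egf (bernoulliSum t)
  same k = R.trans (⊘-correct (divide-z (z ⊛ exp t)) g g₀≈1 k) (R.sym (bernoulliSum-gf t k))
  regroup : ∀ a b c → a * (b * c) ≈ (a * c) * b
  regroup a b c = pointwise λ p →
    solve 3 (λ a b c → a :* (b :* c) := (a :* c) :* b) ≡.refl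
      (seq a p) (seq b p) (seq c p)

-- The substitution t = - a / m

[mj-a]^n : ∀ a m .{{_ : NonZero m}} n j →
  (fromℕ m * fromℕ j - a) ^ n ≈ fromℕ (m ℕ.^ n) * power ((- a) / m) n j
[mj-a]^n a m n j = begin
  (fromℕ m * fromℕ j - a) ^ n
    ≈⟨ ^-congˡ n mj-a ⟩
  (fromℕ m * (t + fromℕ j)) ^ n
    ≈⟨ ^-distrib-* (fromℕ m) (t + fromℕ j) n ⟩
  fromℕ m ^ n * (t + fromℕ j) ^ n
    ≈⟨ R.*-congʳ (fromℕ-^ m n) ⟨
  fromℕ (m ℕ.^ n) * (t + fromℕ j) ^ n
    ∎
  where
  t = (- a) / m
  factor : ∀ m j a r → m * j - (m * r) * a ≈ m * (- a * r + j)
  factor m j a r = pointwise λ p →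
    solve 4 (λ m j a r → m :* j :- (m :* r) :* a := m :* (:- a :* r :+ j)) ≡.refl
      (seq m p) (seq j p) (seq a p) (seq r p)
  mj-a : fromℕ m * fromℕ j - a ≈ fromℕ m * (t + fromℕ j)
  mj-a = begin
    fromℕ m * fromℕ j - a                           ≈⟨ R.+-congˡ (R.-‿cong (R.*-identityˡ a)) ⟨
    -- The coefficient 1 of `a` is traded for m * (1 / m), after which the claim is a polynomial
    -- identity in m, j, a and 1 / m.
    fromℕ m * fromℕ j - 1ℝ * a                      ≈⟨ R.+-congˡ (R.-‿cong (R.*-congʳ (recip-inverse m))) ⟨
    fromℕ m * fromℕ j - (fromℕ m * recip m) * a     ≈⟨ factor (fromℕ m) (fromℕ j) a (recip m) ⟩
    fromℕ m * (t + fromℕ j)                         ∎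

mainTheorem3 : (a : ℝ) (m : ℕ) .{{_ : NonZero m}} (n : ℕ) →
    bernoulli n ((- a) / m) ≈
      ∑[ k ≤ n ] ∑[ j ≤ toℕ k ]
        (fromℕ (toℕ k C toℕ j) * (fromℕ m * fromℕ (toℕ j) - a) ^ n
          * ((- 1ℝ) ^ toℕ j / (m ℕ.^ n ℕ.* suc (toℕ k))) {{m^n*[1+k]≢0 m n (toℕ k)}})
mainTheorem3 a m n = R.trans (bernoulli≈bernoulliSum n t) (sum-cong (suc n) (λ k → outer (toℕ k)))
  where
  t = (- a) / m
  r : ℕ → ℝ
  r k = recip (m ℕ.^ n ℕ.* suc k) {{m^n*[1+k]≢0 m n k}}
  summand : ℕ → ℕ → ℝ
  summand k j = fromℕ (k C j) * (fromℕ m * fromℕ j - a) ^ n * ((- 1ℝ) ^ j * r k)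
  -- Expanding 1 / (k + 1) by m^n supplies the factor that turns (t + j)^n into (m j - a)^n.
  r-cancel : ∀ k → recip (suc k) ≈ fromℕ (m ℕ.^ n) * r k
  r-cancel k = R.sym (recip-unique (suc k) (begin
    fromℕ (suc k) * (fromℕ (m ℕ.^ n) * r k)   ≈⟨ regroup (fromℕ (suc k)) (fromℕ (m ℕ.^ n)) (r k) ⟩
    (fromℕ (m ℕ.^ n) * fromℕ (suc k)) * r k   ≈⟨ R.*-congʳ (fromℕ-* (m ℕ.^ n) (suc k)) ⟨
    fromℕ (m ℕ.^ n ℕ.* suc k) * r k           ≈⟨ recip-inverse (m ℕ.^ n ℕ.* suc k) {{m^n*[1+k]≢0 m n k}} ⟩
    1ℝ                                        ∎))
    where
    regroup : ∀ a b c → a * (b * c) ≈ (b * a) * c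
    regroup a b c = pointwise λ p →
      solve 3 (λ a b c → a :* (b :* c) := (b :* a) :* c) ≡.refl
        (seq a p) (seq b p) (seq c p)
  rearrange : ∀ u r c s x → (u * r) * ((c * s) * x) ≈ c * (u * x) * (s * r)
  rearrange u r c s x = pointwise λ p →
    solve 5 (λ u r c s x → (u :* r) :* ((c :* s) :* x) := c :* (u :* x) :* (s :* r)) ≡.refl
      (seq u p) (seq r p) (seq c p) (seq s p) (seq x p)
  inner : ∀ k j → recip (suc k) * (sign k j * power t n j) ≈ summand k j
  inner k j = begin
    recip (suc k) * (sign k j * power t n j)
      ≈⟨ R.*-congʳ (r-cancel k) ⟩
    (fromℕ (m ℕ.^ n) * r k) * (sign k j * power t n j)
      ≈⟨ rearrange (fromℕ (m ℕ.^ n)) (r k) (fromℕ (k C j)) ((- 1ℝ) ^ j) (power t n j) ⟩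
    fromℕ (k C j) * (fromℕ (m ℕ.^ n) * power t n j) * ((- 1ℝ) ^ j * r k)
      ≈⟨ R.*-congʳ (R.*-congˡ ([mj-a]^n a m n j)) ⟨
    summand k j
      ∎
  outer : ∀ k → recip (suc k) * δ k (power t n) ≈ ∑[ j ≤ k ] summand k (toℕ j)
  outer k = begin
    recip (suc k) * δ k (power t n)
      ≈⟨ R.*-congˡ {recip (suc k)} (δ-binomial k (power t n)) ⟩
    recip (suc k) * ∑[ j ≤ k ] (sign k (toℕ j) * power t n (toℕ j))
      ≈⟨ *-distribˡ-sum {suc k} (recip (suc k)) (λ j → sign k (toℕ j) * power t n (toℕ j)) ⟩
    ∑[ j ≤ k ] (recip (suc k) * (sign k (toℕ j) * power t n (toℕ j)))
      ≈⟨ sum-cong (suc k) (λ j → inner k (toℕ j)) ⟩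
    ∑[ j ≤ k ] summand k (toℕ j)
      ∎
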